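{- For all formulas of $\mathbf{L_1}$: if $\vdash_T F[A_+]$ and $\vdash_T G[A_-]$, then $\vdash_T F[\ {}_+]\vee G[\ {}_-]$ (whenever this is a formula, i.e. not both removals are empty). Thus the cut rule is admissible in the tableau calculus for $\mathbf{L_1}$.
   Context: Formulas of $\mathbf{L_1}$: built from atomic formulas $\epsilon ab$ ($a,b$ name variables, possibly equal) with connectives $\vee,\sim$. Disjunctions may be associated in any way. Positive/negative parts (occurrences): $A$ is a positive part of $A$; if $B\vee C$ is a positive part then $B,C$ are positive parts; if $\sim B$ is a positive part then $B$ is a negative part; if $\sim B$ is a negative part then $B$ is a positive part. $F[B_+]$ ($G[B_-]$) denotes a formula with a specified occurrence of $B$ as positive (negative) part; $F[B_+,C_-]$ etc. denote specified non-overlapping occurrences. Removal: $F[\ {}_+]$ (resp. $G[\ {}_-]$) is the formula or empty expression obtained by deleting the specified occurrence: if $F[A_+]$ is $A$ then $F[\ {}_+]$ is empty; if $F[A_+]$ is $F_1[(A\vee B)_+]$ or $F_1[(B\vee A)_+]$ then $F[\ {}_+]=F_1[B_+]$; if $F[A_+]$ is $G_1[(\sim A)_-]$ then $F[\ {}_+]=G_1[\ {}_-]$; if $G[A_-]$ is $F_1[(\sim A)_+]$ then $G[\ {}_-]=F_1[\ {}_+]$. The disjunction of the empty expression with a formula $C$ is $C$. Tableaux: reduction rules ($\vee_-$) $G[B\vee C_-]$ $\mapsto$ two branches $G[B\vee C_-]\vee\sim B$, $G[B\vee C_-]\vee\sim C$; ($\epsilon_1$) $G[\epsilon ab_-]\mapsto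 G[\epsilon ab_-]\vee\sim\epsilon aa$; ($\epsilon_2$) $G[\epsilon ab_-,\epsilon bc_-]\mapsto G[\epsilon ab_-,\epsilon bc_-]\vee\sim\epsilon ac$; ($\epsilon_{3b}$) $G[\epsilon ab_-,\epsilon bb_-]\mapsto G[\epsilon ab_-,\epsilon bb_-]\vee\sim\epsilon ba$. A tableau for $A$ is a finite tree with root $A$ whose non-leaf nodes have as children the result of applying one rule. A branch is closed if its last formula has the form $F[B_+,B_-]$; a tableau is closed if all branches are. $\vdash_T A$: $A$ has a closed tableau. -}

module Defs where

open import Data.List using (List; []; _∷_; _++_)
open import Data.List.Relation.Unary.All using (All)
open import Data.Maybe using (Maybe; just; nothing)
open import Data.Nat using (ℕ)
open import Data.Product using (Σ; Σ-syntax; ∃-syntax; _×_)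
open import Relation.Nullary using (¬_)

Name : Set
Name = ℕ

infixr 5 _∨_
infix  6 ∼_

data Formula : Set where
  ε   : Name → Name → Formula
  _∨_ : Formula → Formula → Formula
  ∼_  : Formula → Formula

data Sign : Set where
  pos neg : Sign

-- An element of Part F s B is one specified occurrence of B as an s-part of F:
-- distinct occurrences are distinct elements.  A pair (F , p : Part F pos A)
-- renders the notation F[A₊], and (G , q : Part G neg A) renders G[A₋].
data Part (F : Formula) : Sign → Formula → Set where
  whole : Part F pos F
  ∨ˡ    : ∀ {B C} → Part F pos (B ∨ C) → Part F pos B
  ∨ʳ    : ∀ {B C} → Part F pos (B ∨ C) → Part F pos C
  ∼⁺    : ∀ {B} → Part F pos (∼ B) → Part F neg B
  ∼⁻    : ∀ {B} → Part F neg (∼ B) → Part F pos B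

-- p ⊑ q : the occurrence p lies inside (or is) the occurrence q.
infix 4 _⊑_

data _⊑_ {F : Formula} : ∀ {s t B C} → Part F s B → Part F t C → Set where
  here : ∀ {s B} {p : Part F s B} → p ⊑ p
  ∨ˡ   : ∀ {t B C D} {p : Part F pos (B ∨ C)} {q : Part F t D} → p ⊑ q → ∨ˡ p ⊑ q
  ∨ʳ   : ∀ {t B C D} {p : Part F pos (B ∨ C)} {q : Part F t D} → p ⊑ q → ∨ʳ p ⊑ q
  ∼⁺   : ∀ {t B D} {p : Part F pos (∼ B)} {q : Part F t D} → p ⊑ q → ∼⁺ p ⊑ q
  ∼⁻   : ∀ {t B D} {p : Part F neg (∼ B)} {q : Part F t D} → p ⊑ q → ∼⁻ p ⊑ q

-- Two occurrences of subformulas overlap exactly when one lies inside the other.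
NonOverlapping : ∀ {F s t B C} → Part F s B → Part F t C → Set
NonOverlapping p q = ¬ (p ⊑ q) × ¬ (q ⊑ p)

-- If p specifies F[B], then replace p D is F[D].
replace : ∀ {F s B} → Part F s B → Formula → Formula
replace whole          D = D
replace (∨ˡ {C = C} p) D = replace p (D ∨ C)
replace (∨ʳ {B = B} p) D = replace p (B ∨ D)
replace (∼⁺ p)         D = replace p (∼ D)
replace (∼⁻ p)         D = replace p (∼ D)

-- F[ ₊] and G[ ₋]; nothing is the empty expression.
remove : ∀ {F s B} → Part F s B → Maybe Formula
remove whole          = nothing
remove (∨ˡ {C = C} p) = just (replace p C)
remove (∨ʳ {B = B} p) = just (replace p B)
remove (∼⁺ p)         = remove p
remove (∼⁻ p)         = remove p

infixr 5 _∨?_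

_∨?_ : Maybe Formula → Maybe Formula → Maybe Formula
nothing ∨? Y       = Y
just B  ∨? nothing = just B
just B  ∨? just C  = just (B ∨ C)

data Tableau (G : Formula) : Set where
  leaf : Tableau G
  ∨₋   : ∀ {B C} → Part G neg (B ∨ C) →
         Tableau (G ∨ ∼ B) → Tableau (G ∨ ∼ C) → Tableau G
  ε₁   : ∀ {a b} → Part G neg (ε a b) →
         Tableau (G ∨ ∼ ε a a) → Tableau G
  ε₂   : ∀ {a b c} (p : Part G neg (ε a b)) (q : Part G neg (ε b c)) →
         NonOverlapping p q →
         Tableau (G ∨ ∼ ε a c) → Tableau G
  ε₃b  : ∀ {a b} (p : Part G neg (ε a b)) (q : Part G neg (ε b b)) →
         NonOverlapping p q →
         Tableau (G ∨ ∼ ε b a) → Tableau G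

-- The last formula of each branch.
lasts : ∀ {G} → Tableau G → List Formula
lasts {G} leaf       = G ∷ []
lasts (∨₋ _ t u)     = lasts t ++ lasts u
lasts (ε₁ _ t)       = lasts t
lasts (ε₂ _ _ _ t)   = lasts t
lasts (ε₃b _ _ _ t)  = lasts t

-- F has the form F[B₊,B₋].
Closing : Formula → Set
Closing F = ∃[ B ] Σ[ p ∈ Part F pos B ] Σ[ q ∈ Part F neg B ] NonOverlapping p q

Closed : ∀ {G} → Tableau G → Set
Closed t = All Closing (lasts t)

infix 3 ⊢T_

⊢T_ : Formula → Set
⊢T A = Σ[ t ∈ Tableau A ] Closed t

{-# OPTIONS --safe #-}
-- Which tableau rules apply to a formula G, and whether G closes, depends only
-- on its "literals": the atomic positive and negative parts together with the
-- negative disjunctions.  On lists of literals the tableau rules form a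
-- one-sided sequent calculus whose contexts only grow, so weakening and
-- contraction are free, and cut is eliminated by induction on the cut formula.
-- Negation only swaps the two premises.  Disjunction is reduced by inverting
-- the rule ∨₋.  An atomic cut formula is never principal on its positive side
-- except in a closure, where the other premise already gives the conclusion.
module Submission where

open import Data.Empty using (⊥-elim)
open import Data.List using (List; []; _∷_; _++_; [_])
open import Data.List.Membership.Propositional using (_∈_)
open import Data.List.Membership.Propositional.Properties using (∈-++⁻)
open import Data.List.Relation.Binary.Subset.Propositional using (_⊆_)
open import Data.List.Relation.Binary.Subset.Propositional.Properties
  using (⊆-refl; ⊆-trans; ++⁺ˡ; ++⁺ʳ; ∷⁺ʳ; ∈-∷⁺ʳ; xs⊆xs++ys; xs⊆ys++xs)
open import Data.List.Relation.Unary.All using ([]; _∷_)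
open import Data.List.Relation.Unary.All.Properties using (++⁺; ++⁻ˡ; ++⁻ʳ)
open import Data.List.Relation.Unary.Any using (here; there)
open import Data.Maybe using (Maybe; just; nothing)
open import Data.Nat.Properties using (_≟_)
open import Data.Product using (_×_; _,_)
open import Data.Sum using (_⊎_; inj₁; inj₂; [_,_]′)
open import Function using (_∘_)
open import Relation.Binary.PropositionalEquality using (_≡_; _≢_; refl; subst; sym)
open import Relation.Nullary using (yes; no)
open import Defs

-- Literals and the sequent calculus on them

Literal : Set
Literal = Sign × Formula

Context : Set
Context = List Literal

private
  variable
    F G B C D : Formula
    Γ Δ : Context
    s t : Sign
    a b c d : Name

-- The maximal decomposition that needs no branching.
lits : Sign → Formula → Context
lits s   (ε a b) = [ s , ε a b ]
lits pos (B ∨ C) = lits pos B ++ lits pos C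
lits neg (B ∨ C) = [ neg , B ∨ C ]
lits pos (∼ B)   = lits neg B
lits neg (∼ B)   = lits pos B

++-⊆ : ∀ X → X ⊆ Δ → Γ ⊆ Δ → X ++ Γ ⊆ Δ
++-⊆ X f g = [ f , g ]′ ∘ ∈-++⁻ X

part⇒lits : Part F s B → lits s B ⊆ lits pos F
part⇒lits whole  = ⊆-refl
part⇒lits (∨ˡ p) = ⊆-trans (xs⊆xs++ys _ _) (part⇒lits p)
part⇒lits (∨ʳ {B = B} p) = ⊆-trans (xs⊆ys++xs _ (lits pos B)) (part⇒lits p)
part⇒lits (∼⁺ p) = part⇒lits p
part⇒lits (∼⁻ p) = part⇒lits p

lits⇒part : ∀ s B → Part F s B → (t , D) ∈ lits s B → Part F t D
lits⇒part s   (ε _ _) p (here refl) = p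
lits⇒part pos (B ∨ C) p i =
  [ lits⇒part pos B (∨ˡ p) , lits⇒part pos C (∨ʳ p) ]′ (∈-++⁻ (lits pos B) i)
lits⇒part neg (B ∨ C) p (here refl) = p
lits⇒part pos (∼ B)   p i = lits⇒part neg B (∼⁺ p) i
lits⇒part neg (∼ B)   p i = lits⇒part pos B (∼⁻ p) i

data Infer (Γ : Context) : Name → Name → Set where
  ε₁  : (neg , ε a b) ∈ Γ → Infer Γ a a
  ε₂  : (neg , ε a b) ∈ Γ → (neg , ε b c) ∈ Γ → Infer Γ a c
  ε₃b : (neg , ε a b) ∈ Γ → (neg , ε b b) ∈ Γ → Infer Γ b a

infix 3 ⊢_

-- New literals are appended on the right, so that `lits pos (G ∨ ∼ B)` unfolds to exactly the
-- context of the corresponding premise.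
data ⊢_ (Γ : Context) : Set where
  ax    : (pos , ε a b) ∈ Γ → (neg , ε a b) ∈ Γ → ⊢ Γ
  ∨₋    : (neg , B ∨ C) ∈ Γ → ⊢ Γ ++ lits neg B → ⊢ Γ ++ lits neg C → ⊢ Γ
  infer : Infer Γ a b → ⊢ Γ ++ [ neg , ε a b ] → ⊢ Γ

Infer-map : (∀ {a b} → (neg , ε a b) ∈ Γ → (neg , ε a b) ∈ Δ) →
            Infer Γ a b → Infer Δ a b
Infer-map f (ε₁ i)    = ε₁ (f i)
Infer-map f (ε₂ i j)  = ε₂ (f i) (f j)
Infer-map f (ε₃b i j) = ε₃b (f i) (f j)

weaken : Γ ⊆ Δ → ⊢ Γ → ⊢ Δ
weaken f (ax i j)    = ax (f i) (f j)
weaken f (∨₋ i d e)  = ∨₋ (f i) (weaken (++⁺ˡ _ f) d) (weaken (++⁺ˡ _ f) e)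
weaken f (infer r d) = infer (Infer-map f r) (weaken (++⁺ˡ _ f) d)

-- A closing pair may be compound: splitting its negative disjunctions leads down to atomic
-- closures.
axiom : ∀ B → lits pos B ⊆ Γ → lits neg B ⊆ Γ → ⊢ Γ
axiom (ε a b) f g = ax (f (here refl)) (g (here refl))
axiom (B ∨ C) f g = ∨₋ (g (here refl))
  (axiom B (⊆-trans (⊆-trans (xs⊆xs++ys _ _) f) (xs⊆xs++ys _ _)) (xs⊆ys++xs _ _))
  (axiom C (⊆-trans (⊆-trans (xs⊆ys++xs _ (lits pos B)) f) (xs⊆xs++ys _ _))
           (xs⊆ys++xs _ _))
axiom (∼ B)   f g = axiom B g f

-- Cut admissibility

strengthen : ∀ {ℓ m : Literal} → ℓ ≢ m → Δ ⊆ m ∷ Γ → ℓ ∈ Δ → ℓ ∈ Γ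
strengthen ne f i with f i
... | here eq = ⊥-elim (ne eq)
... | there j = j

-- Wherever `B ∨ C` is split, only the branch for `D` is kept. Its new literals already lie in `Γ`,
-- so the bound on `Δ` survives. Stating that bound as an inclusion covers repeated uses of `B ∨ C`.
∨₋-invert : D ≡ B ⊎ D ≡ C → lits neg D ⊆ Γ → Δ ⊆ (neg , B ∨ C) ∷ Γ → ⊢ Δ → ⊢ Γ
∨₋-invert h g f (ax i j) = ax (strengthen (λ ()) f i) (strengthen (λ ()) f j)
∨₋-invert h g f (infer r d) =
  infer (Infer-map (strengthen (λ ()) f) r)
        (∨₋-invert h (⊆-trans g (xs⊆xs++ys _ _)) (++⁺ˡ _ f) d)
∨₋-invert {Δ = Δ} h g f (∨₋ i d e) with f i | h
... | there j   | _         =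
  ∨₋ j (∨₋-invert h (⊆-trans g (xs⊆xs++ys _ _)) (++⁺ˡ _ f) d)
       (∨₋-invert h (⊆-trans g (xs⊆xs++ys _ _)) (++⁺ˡ _ f) e)
... | here refl | inj₁ refl = ∨₋-invert h g (++-⊆ Δ f (there ∘ g)) d
... | here refl | inj₂ refl = ∨₋-invert h g (++-⊆ Δ f (there ∘ g)) e

-- The cut moves up the first derivation. If a closure uses the cut atom, its negative partner lies
-- in `Γ`, and the second derivation contracts to `Γ`.
cut-ε : Δ ⊆ (pos , ε a b) ∷ Γ → ⊢ Δ → ⊢ (neg , ε a b) ∷ Γ → ⊢ Γ
cut-ε f (ax i j) e with f i
... | there k   = ax k (strengthen (λ ()) f j)
... | here refl = weaken (∈-∷⁺ʳ (strengthen (λ ()) f j) ⊆-refl) e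
cut-ε f (∨₋ i d₁ d₂) e =
  ∨₋ (strengthen (λ ()) f i)
     (cut-ε (++⁺ˡ _ f) d₁ (weaken (∷⁺ʳ _ (xs⊆xs++ys _ _)) e))
     (cut-ε (++⁺ˡ _ f) d₂ (weaken (∷⁺ʳ _ (xs⊆xs++ys _ _)) e))
cut-ε f (infer r d) e =
  infer (Infer-map (strengthen (λ ()) f) r)
        (cut-ε (++⁺ˡ _ f) d (weaken (∷⁺ʳ _ (xs⊆xs++ys _ _)) e))

cut : ∀ A → ⊢ lits pos A ++ Γ → ⊢ lits neg A ++ Γ → ⊢ Γ
cut (ε a b) d e = cut-ε ⊆-refl d e
cut (∼ A)   d e = cut A e d
cut {Γ} (B ∨ C) d e =
  -- The inner cut on `C` happens with `lits pos B` still in the context; the outer one then removes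
  -- `B`.
  cut B (cut C (weaken reorder d)
               (weaken (++⁺ʳ (lits neg C) (xs⊆ys++xs Γ (lits pos B))) eC))
        eB
  where
  eB : ⊢ lits neg B ++ Γ
  eB = ∨₋-invert (inj₁ refl) (xs⊆xs++ys _ _)
         (∷⁺ʳ _ (xs⊆ys++xs Γ (lits neg B))) e
  eC : ⊢ lits neg C ++ Γ
  eC = ∨₋-invert (inj₂ refl) (xs⊆xs++ys _ _)
         (∷⁺ʳ _ (xs⊆ys++xs Γ (lits neg C))) e
  reorder : (lits pos B ++ lits pos C) ++ Γ ⊆ lits pos C ++ lits pos B ++ Γ
  reorder = ++-⊆ (lits pos B ++ lits pos C)
    (++-⊆ (lits pos B)
      (⊆-trans (xs⊆xs++ys _ Γ) (xs⊆ys++xs _ (lits pos C)))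
      (xs⊆xs++ys _ _))
    (⊆-trans (xs⊆ys++xs _ (lits pos B)) (xs⊆ys++xs _ (lits pos C)))

-- Translation between tableaux and the calculus on literals

negLit : Part F neg (ε a b) → (neg , ε a b) ∈ lits pos F
negLit p = part⇒lits p (here refl)

fromTableau : (t : Tableau F) → Closed t → ⊢ lits pos F
fromTableau leaf ((B , p , q , _) ∷ []) = axiom B (part⇒lits p) (part⇒lits q)
fromTableau (∨₋ p t u) cl =
  ∨₋ (part⇒lits p (here refl)) (fromTableau t (++⁻ˡ (lasts t) cl))
                               (fromTableau u (++⁻ʳ (lasts t) cl))
fromTableau (ε₁ p t)      cl = infer (ε₁ (negLit p)) (fromTableau t cl)
fromTableau (ε₂ p q _ t)  cl = infer (ε₂ (negLit p) (negLit q)) (fromTableau t cl)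
fromTableau (ε₃b p q _ t) cl = infer (ε₃b (negLit p) (negLit q)) (fromTableau t cl)

-- An atom has no proper parts: a step further inside would make a compound formula equal to
-- `ε a b`.
⊑-atom : {p : Part F s B} {q : Part F t (ε a b)} → p ⊑ q → (s , B) ≡ (t , ε a b)
⊑-atom here = refl
⊑-atom (∨ˡ x) with () ← ⊑-atom x
⊑-atom (∨ʳ x) with () ← ⊑-atom x
⊑-atom (∼⁺ x) with () ← ⊑-atom x
⊑-atom (∼⁻ x) with () ← ⊑-atom x

atoms-nonOverlapping : (p : Part F s (ε a b)) (q : Part F t (ε c d)) →
                       (s , ε a b) ≢ (t , ε c d) → NonOverlapping p q
atoms-nonOverlapping p q ne = ne ∘ ⊑-atom , ne ∘ sym ∘ ⊑-atom

-- In ε₂ and ε₃b with a = b the two premises may be the same occurrence, which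
-- the tableau rules forbid; but then the conclusion is one of the premises.
toTableau : Γ ⊆ lits pos G → ⊢ Γ → ⊢T G
toTableau {Γ} {G} f = go
  where
  part : (t , D) ∈ Γ → Part G t D
  part i = lits⇒part pos G whole (f i)

  go : ⊢ Γ → ⊢T G
  go (ax i j) =
    leaf , (_ , part i , part j , atoms-nonOverlapping _ _ λ ()) ∷ []
  go (∨₋ i d e) =
    let t , t-closed = toTableau (++⁺ˡ _ f) d
        u , u-closed = toTableau (++⁺ˡ _ f) e
    in ∨₋ (part i) t u , ++⁺ t-closed u-closed
  go (infer (ε₁ i) d) =
    let t , t-closed = toTableau (++⁺ˡ _ f) d in ε₁ (part i) t , t-closed
  go (infer (ε₂ {a} {b} i j) d) with a ≟ b
  ... | yes refl = toTableau (++-⊆ Γ f (∈-∷⁺ʳ (f j) λ ())) d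
  -- Equality of the two premise atoms would force `a` and `b` to coincide.
  ... | no a≢b   =
    let t , t-closed = toTableau (++⁺ˡ _ f) d
    in ε₂ (part i) (part j)
          (atoms-nonOverlapping _ _ λ { refl → a≢b refl }) t , t-closed
  go (infer (ε₃b {a} {b} i j) d) with a ≟ b
  ... | yes refl = toTableau (++-⊆ Γ f (∈-∷⁺ʳ (f j) λ ())) d
  ... | no a≢b   =
    let t , t-closed = toTableau (++⁺ˡ _ f) d
    in ε₃b (part i) (part j)
           (atoms-nonOverlapping _ _ λ { refl → a≢b refl }) t , t-closed

-- Removal of a part

lits? : Maybe Formula → Context
lits? nothing  = []
lits? (just B) = lits pos B

-- `X` collects the literals lost in the replacement. A bound at the hole passes outwards because
-- each enclosing disjunction only adds literals common to both sides.
replace-lits : ∀ X (p : Part F s B) → lits s B ⊆ X ++ lits s D →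
               lits pos F ⊆ X ++ lits pos (replace p D)
replace-lits X whole h = h
replace-lits {D = D} X (∨ˡ {B} p) h = replace-lits X p
  (++-⊆ (lits pos B)
    (⊆-trans h (++⁺ʳ X (xs⊆xs++ys _ _)))
    (⊆-trans (xs⊆ys++xs _ (lits pos D)) (xs⊆ys++xs _ X)))
replace-lits X (∨ʳ {B} p) h = replace-lits X p
  (++-⊆ (lits pos B)
    (⊆-trans (xs⊆xs++ys _ _) (xs⊆ys++xs _ X))
    (⊆-trans h (++⁺ʳ X (xs⊆ys++xs _ (lits pos B)))))
replace-lits X (∼⁺ p) h = replace-lits X p h
replace-lits X (∼⁻ p) h = replace-lits X p h

remove-lits : (p : Part F s B) → lits pos F ⊆ lits s B ++ lits? (remove p)
remove-lits whole  = xs⊆xs++ys _ _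
remove-lits (∨ˡ {B} p) = replace-lits (lits pos B) p ⊆-refl
remove-lits (∨ʳ {B} {C} p) = replace-lits (lits pos C) p
  (++-⊆ (lits pos B) (xs⊆ys++xs _ (lits pos C)) (xs⊆xs++ys _ _))
remove-lits (∼⁺ p) = remove-lits p
remove-lits (∼⁻ p) = remove-lits p

lits?-∨?ˡ : ∀ M N → lits? M ⊆ lits? (M ∨? N)
lits?-∨?ˡ nothing  _        ()
lits?-∨?ˡ (just _) nothing  = ⊆-refl
lits?-∨?ˡ (just _) (just _) = xs⊆xs++ys _ _

lits?-∨?ʳ : ∀ M N → lits? N ⊆ lits? (M ∨? N)
lits?-∨?ʳ nothing  _        = ⊆-refl
lits?-∨?ʳ (just _) nothing  ()
lits?-∨?ʳ (just B) (just _) = xs⊆ys++xs _ (lits pos B)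

theorem8p1 : (F G A : Formula) (p : Part F pos A) (q : Part G neg A) →
    ⊢T F → ⊢T G →
    (H : Formula) → remove p ∨? remove q ≡ just H → ⊢T H
theorem8p1 F G A p q (t , t-closed) (u , u-closed) H eq =
  -- Reading the empty expression as the empty context lets one cut cover all cases of empty
  -- removals.
  toTableau (subst (λ M → lits? (remove p ∨? remove q) ⊆ lits? M) eq ⊆-refl)
    (cut A (weaken F⊆ (fromTableau t t-closed)) (weaken G⊆ (fromTableau u u-closed)))
  where
  F⊆ : lits pos F ⊆ lits pos A ++ lits? (remove p ∨? remove q)
  F⊆ = ⊆-trans (remove-lits p)
         (++⁺ʳ (lits pos A) (lits?-∨?ˡ (remove p) (remove q)))
  G⊆ : lits pos G ⊆ lits neg A ++ lits? (remove p ∨? remove q)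
  G⊆ = ⊆-trans (remove-lits q)
         (++⁺ʳ (lits neg A) (lits?-∨?ʳ (remove p) (remove q)))
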